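{- The omitted blocks have unbounded absolute length: $G(n)\to\infty$ as $n\to\infty$. At the same time, $\dfrac{G(n)}{H(n)}\to0$ as $n\to\infty$. Consequently, $\dfrac{H(n+1)}{H(n)}\to1$ as $n\to\infty$.
   Context: $p(n)$ denotes the number of (unrestricted) partitions of the positive integer $n$, $H(n):=p(n)-n$, and for $n\ge3$ the gap length is $G(n):=H(n+1)-H(n)-1$, i.e. the number of integers strictly between the consecutive attained values $H(n)$ and $H(n+1)$ (the length of the omitted block between them). -}

module Defs where

open import Data.Nat as ℕ using (ℕ; zero; suc; z≤n; s≤s)
import Data.Nat.Properties as ℕ
open import Data.Nat.ListAction using (sum)
open import Data.Integer as ℤ using (ℤ; +_)
open import Data.Rational as ℚ using (ℚ; 0ℚ; NonZero; _÷_; ∣_∣)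
open import Data.List.Base using (List; []; _∷_; length; filter; upTo; cartesianProductWith)
open import Data.List.Properties using (∷-injective)
open import Data.List.Membership.Propositional using (_∈_)
open import Data.List.Membership.Propositional.Properties
  using (∈-cartesianProductWith⁺; ∈-cartesianProductWith⁻; ∈-filter⁺; ∈-filter⁻; ∈-upTo⁺)
open import Data.List.Relation.Unary.All as All using (All; []; _∷_)
open import Data.List.Relation.Unary.Any using (here; there)
open import Data.List.Relation.Unary.Linked using (Linked; linked?)
open import Data.List.Relation.Unary.Unique.Propositional using (Unique; []; _∷_)
open import Data.List.Relation.Unary.Unique.Propositional.Properties
  using (upTo⁺; filter⁺; cartesianProductWith⁺)
open import Data.Product using (Σ-syntax; ∃-syntax; _×_; _,_; proj₂)
open import Function using (_∘_; _⇔_; mk⇔)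
open import Relation.Binary.PropositionalEquality using (_≡_; _≢_; refl)
open import Relation.Nullary using (Dec)
open import Relation.Nullary.Decidable using (_×-dec_)

-- A partition of n is written with its parts in weakly decreasing order.
IsPartition : ℕ → List ℕ → Set
IsPartition n xs = Linked ℕ._≥_ xs × All (1 ℕ.≤_) xs × sum xs ≡ n

isPartition? : ∀ n xs → Dec (IsPartition n xs)
isPartition? n xs =
  linked? ℕ._≥?_ xs ×-dec All.all? (1 ℕ.≤?_) xs ×-dec sum xs ℕ.≟ n

-- words as m: all lists of length at most m with entries from as.
words : List ℕ → ℕ → List (List ℕ)
words as zero    = [] ∷ []
words as (suc m) = [] ∷ cartesianProductWith _∷_ as (words as m)

-- A partition of n has at most n parts, each at most n, so this list contains
-- every partition of n; ∈-partitions and partitions-unique below confirm that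
-- it lists the partitions of n exactly once each.
partitions : ℕ → List (List ℕ)
partitions n = filter (isPartition? n) (words (upTo (suc n)) n)

p : ℕ → ℕ
p n = length (partitions n)

private
  ∈-words : ∀ {as m xs} → All (_∈ as) xs → length xs ℕ.≤ m → xs ∈ words as m
  ∈-words {m = zero}  []       _       = here refl
  ∈-words {m = suc m} []       _       = here refl
  ∈-words {m = suc m} (i ∷ is) (s≤s l) =
    there (∈-cartesianProductWith⁺ _∷_ i (∈-words is l))

  words-unique : ∀ {as} → Unique as → ∀ m → Unique (words as m)
  words-unique u zero    = [] ∷ []
  words-unique {as} u (suc m) =
    All.tabulate nonempty ∷ cartesianProductWith⁺ _∷_ ∷-injective u (words-unique u m)
    where
    nonempty : ∀ {ys} → ys ∈ cartesianProductWith _∷_ as (words as m) → [] ≢ ys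
    nonempty i refl with ∈-cartesianProductWith⁻ _∷_ as (words as m) i
    ... | _ , _ , _ , _ , ()

  length≤sum : ∀ {xs} → All (1 ℕ.≤_) xs → length xs ℕ.≤ sum xs
  length≤sum []       = z≤n
  length≤sum (h ∷ hs) = ℕ.+-mono-≤ h (length≤sum hs)

  parts≤sum : ∀ xs → All (ℕ._≤ sum xs) xs
  parts≤sum []       = []
  parts≤sum (x ∷ xs) =
    ℕ.m≤m+n x _ ∷ All.map (λ h → ℕ.≤-trans h (ℕ.m≤n+m _ x)) (parts≤sum xs)

∈-partitions : ∀ n xs → xs ∈ partitions n ⇔ IsPartition n xs
∈-partitions n xs = mk⇔ (proj₂ ∘ ∈-filter⁻ (isPartition? n) {xs = words (upTo (suc n)) n}) complete
  where
  complete : IsPartition n xs → xs ∈ partitions n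
  complete π@(_ , pos , refl) = ∈-filter⁺ (isPartition? n)
    (∈-words (All.map (∈-upTo⁺ ∘ s≤s) (parts≤sum xs)) (length≤sum pos)) π

partitions-unique : ∀ n → Unique (partitions n)
partitions-unique n = filter⁺ (isPartition? n) (words-unique (upTo⁺ (suc n)) n)

H : ℕ → ℤ
H n = + p n ℤ.- + n

G : ℕ → ℤ
G n = H (suc n) ℤ.- H n ℤ.- ℤ.1ℤ

ι : ℤ → ℚ
ι z = z ℚ./ 1

TendsToInfinity : (ℕ → ℤ) → Set
TendsToInfinity a = ∀ (M : ℤ) → ∃[ N ] ∀ n → n ℕ.≥ N → M ℤ.≤ a n

-- aₙ / bₙ → ℓ.  The quotient need only be defined for large n (H 1 = H 2 = H 3 = 0),
-- and the limit asserts that it is: bₙ ≠ 0 is part of the conclusion for n ≥ N.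
-- It suffices to let ε range over the positive rationals.
QuotientTendsTo : (a b : ℕ → ℚ) → ℚ → Set
QuotientTendsTo a b ℓ =
  ∀ (ε : ℚ) → 0ℚ ℚ.< ε → ∃[ N ] ∀ n → n ℕ.≥ N →
    Σ[ bₙ≢0 ∈ NonZero (b n) ] ∣ _÷_ (a n) (b n) {{bₙ≢0}} ℚ.- ℓ ∣ ℚ.< ε

{-# OPTIONS --safe #-}
-- Write P(n), Q(n), C(n) for the numbers of partitions of n into parts ≥ 1, ≥ 2, ≥ 3.
-- Since p(n+1) - p(n) = Q(n+1), one has G(n) = Q(n+1) - 2, and Q(n) ≥ C(n) + C(n-2) + ...
-- is unbounded.  It remains to show Q = o(P).  If a set S of part sizes has negligible
-- count f and d ≥ 2, then S ∪ {d} has negligible count g: g(n) is the sum of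
-- f(n), f(n-d), ..., f(n-(M-1)d) and g(n-Md), and M g(n-Md) ≤ P(n) because
-- g(n) + P(n-d) ≤ Q(n) + P(n-1) = P(n).  So for fixed l the partitions into parts between
-- 3 and l are negligible.  Those into parts ≥ 3 with largest part > l number at most
-- T(n-l-1), where T(x) = C(0) + ... + C(x), and P(n) = T(n) + T(n-2) + T(n-4) + ... is at
-- least about (l/2) T(n-l).  Hence C = o(P), and adjoining d = 2 gives Q = o(P).
-- Finally n ≤ 2 Q(n+1) + 1 makes n negligible against p(n), so H(n) may replace p(n).
module Submission where

open import Defs
open import Data.Nat
open import Data.Nat.Properties
open import Data.Nat.Induction using (<-rec)
open import Data.Nat.ListAction using (sum)
open import Algebra.Properties.CommutativeSemigroup +-commutativeSemigroup using (interchange)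
open import Data.List using (List; []; _∷_; length; map; _++_)
open import Data.List.Properties using (length-++; length-map; ∷-injectiveʳ)
open import Data.List.Membership.Propositional using (_∈_)
open import Data.List.Membership.Propositional.Properties using (∈-map⁺; ∈-map⁻; ∈-++⁺ˡ; ∈-++⁺ʳ; ∈-++⁻)
open import Data.List.Membership.Propositional.Properties.WithK using (unique∧set⇒bag)
open import Data.List.Relation.Binary.BagAndSetEquality using (∼bag⇒↭)
open import Data.List.Relation.Binary.Permutation.Propositional.Properties using (↭-length)
open import Data.List.Relation.Unary.All as All using (All; []; _∷_)
open import Data.List.Relation.Unary.Any using (here)
open import Data.List.Relation.Unary.Linked as Linked using (Linked; []; [-]; _∷_)
open import Data.List.Relation.Unary.Linked.Properties using (Linked⇒All)
open import Data.List.Relation.Unary.Unique.Propositional using (Unique; []; _∷_)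
open import Data.List.Relation.Unary.Unique.Propositional.Properties using (map⁺; ++⁺)
open import Data.Product using (Σ-syntax; ∃-syntax; _×_; _,_; proj₁; proj₂)
open import Data.Sum using (_⊎_; inj₁; inj₂; [_,_]′)
open import Function using (_∘_; _⇔_; mk⇔; Equivalence)
open import Function.Properties.Equivalence using () renaming (sym to ⇔-sym; trans to ⇔-trans)
open import Relation.Nullary using (¬_; yes; no; contradiction)
open import Relation.Binary.PropositionalEquality
open Equivalence using (to; from)

-- Adjoining a part size

-- Multiplication of the generating function by q^d. Unlike `f (m ∸ d)`, it vanishes for `m < d`.
shift : ℕ → (ℕ → ℕ) → ℕ → ℕ
shift zero    f m       = f m
shift (suc d) f zero    = 0
shift (suc d) f (suc m) = shift d f m

shift-≡ : ∀ d f m → shift d f (d + m) ≡ f m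
shift-≡ zero    f m = refl
shift-≡ (suc d) f m = shift-≡ d f m

shift-< : ∀ d f {m} → m < d → shift d f m ≡ 0
shift-< (suc d) f {zero}  _         = refl
shift-< (suc d) f {suc m} (s≤s m<d) = shift-< d f m<d

shift-cong-≤ : ∀ d {f g} m → (∀ {x} → x ≤ m → f x ≡ g x) → shift d f m ≡ shift d g m
shift-cong-≤ zero    m       f≡g = f≡g ≤-refl
shift-cong-≤ (suc d) zero    f≡g = refl
shift-cong-≤ (suc d) (suc m) f≡g = shift-cong-≤ d m (λ x≤m → f≡g (m≤n⇒m≤1+n x≤m))

shift-cong-< : ∀ d {f g} m → (∀ {x} → x < m → f x ≡ g x) → shift (suc d) f m ≡ shift (suc d) g m
shift-cong-< d zero    f≡g = refl
shift-cong-< d (suc m) f≡g = shift-cong-≤ d m (λ x≤m → f≡g (s≤s x≤m))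

shift-mono : ∀ d {f g} → (∀ x → f x ≤ g x) → ∀ m → shift d f m ≤ shift d g m
shift-mono zero    f≤g m       = f≤g m
shift-mono (suc d) f≤g zero    = z≤n
shift-mono (suc d) f≤g (suc m) = shift-mono d f≤g m

shift-+ : ∀ d f g m → shift d (λ x → f x + g x) m ≡ shift d f m + shift d g m
shift-+ zero    f g m       = refl
shift-+ (suc d) f g zero    = refl
shift-+ (suc d) f g (suc m) = shift-+ d f g m

shift-shift : ∀ d e f m → shift d (shift e f) m ≡ shift (d + e) f m
shift-shift zero    e f m       = refl
shift-shift (suc d) e f zero    = refl
shift-shift (suc d) e f (suc m) = shift-shift d e f m

shift-comm : ∀ d e f m → shift d (shift e f) m ≡ shift e (shift d f) m
shift-comm d e f m = begin
  shift d (shift e f) m ≡⟨ shift-shift d e f m ⟩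
  shift (d + e) f m     ≡⟨ cong (λ k → shift k f m) (+-comm d e) ⟩
  shift (e + d) f m     ≡⟨ shift-shift e d f m ⟨
  shift e (shift d f) m ∎
  where open ≡-Reasoning

*-shift-≤ : ∀ d k f g → (∀ x → k * f x ≤ g (d + x)) → ∀ m → k * shift d f m ≤ g m
*-shift-≤ zero    k f g f≤g m       = f≤g m
*-shift-≤ (suc d) k f g f≤g zero    = ≤-trans (≤-reflexive (*-zeroʳ k)) z≤n
*-shift-≤ (suc d) k f g f≤g (suc m) = *-shift-≤ d k f (λ x → g (suc x)) f≤g m

-- The sum f(m) + f(m-d) + ... + f(m-kd). The fuel `k` makes the recursion structural; `k = m`
-- exhausts the sum when d ≥ 1.
adjoinUpTo : ℕ → ℕ → (ℕ → ℕ) → ℕ → ℕ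
adjoinUpTo zero    d f m = f m
adjoinUpTo (suc k) d f m = f m + shift d (adjoinUpTo k d f) m

-- If f m counts the partitions of m with parts from a set not containing d, then
-- adjoin d f m counts those where d is allowed as well: the generating function
-- is multiplied by 1 / (1 - q^d).  Meaningful for d ≥ 1 only.
opaque
  adjoin : ℕ → (ℕ → ℕ) → ℕ → ℕ
  adjoin d f m = adjoinUpTo m d f m

private
  adjoinUpTo-zero : ∀ k d f → adjoinUpTo k (suc d) f 0 ≡ f 0
  adjoinUpTo-zero zero    d f = refl
  adjoinUpTo-zero (suc k) d f = +-identityʳ (f 0)

  adjoinUpTo-irrelevant : ∀ k l d f {m} → m ≤ k → m ≤ l →
    adjoinUpTo k (suc d) f m ≡ adjoinUpTo l (suc d) f m
  adjoinUpTo-irrelevant k l d f z≤n z≤n =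
    trans (adjoinUpTo-zero k d f) (sym (adjoinUpTo-zero l d f))
  adjoinUpTo-irrelevant (suc k) (suc l) d f {suc m} (s≤s m≤k) (s≤s m≤l) =
    cong (f (suc m) +_) (shift-cong-≤ d m
      (λ x≤m → adjoinUpTo-irrelevant k l d f (≤-trans x≤m m≤k) (≤-trans x≤m m≤l)))

Adjoins : ℕ → (f g : ℕ → ℕ) → Set
Adjoins d f g = ∀ m → g m ≡ f m + shift d g m

opaque
  unfolding adjoin

  adjoin-adjoins : ∀ d f → Adjoins (suc d) f (adjoin (suc d) f)
  adjoin-adjoins d f zero    = sym (+-identityʳ (f 0))
  adjoin-adjoins d f (suc m) = cong (f (suc m) +_) (shift-cong-≤ d m
    (λ {x} x≤m → adjoinUpTo-irrelevant m x d f x≤m ≤-refl))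

-- A positive shift reads `g` only below `m`, so the recurrence determines `g`. Identities for
-- `adjoin` then follow by checking one recurrence for both sides.
adjoins-unique : ∀ d {f g h} → Adjoins (suc d) f g → Adjoins (suc d) f h → g ≗ h
adjoins-unique d {f} {g} {h} fg fh = <-rec (λ m → g m ≡ h m) λ m g≡h → begin
  g m                     ≡⟨ fg m ⟩
  f m + shift (suc d) g m ≡⟨ cong (f m +_) (shift-cong-< d m g≡h) ⟩
  f m + shift (suc d) h m ≡⟨ fh m ⟨
  h m                     ∎
  where open ≡-Reasoning

adjoin-cong : ∀ d {f g} → f ≗ g → adjoin (suc d) f ≗ adjoin (suc d) g
adjoin-cong d {f} {g} f≗g = adjoins-unique d
  (λ m → trans (adjoin-adjoins d f m) (cong (_+ _) (f≗g m))) (adjoin-adjoins d g)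

adjoin-+ : ∀ d f g → adjoin (suc d) (λ m → f m + g m) ≗ λ m → adjoin (suc d) f m + adjoin (suc d) g m
adjoin-+ d f g = adjoins-unique d (adjoin-adjoins d _) λ m → begin
  Af m + Ag m
    ≡⟨ cong₂ _+_ (adjoin-adjoins d f m) (adjoin-adjoins d g m) ⟩
  (f m + shift (suc d) Af m) + (g m + shift (suc d) Ag m)
    ≡⟨ interchange (f m) _ (g m) _ ⟩
  (f m + g m) + (shift (suc d) Af m + shift (suc d) Ag m)
    ≡⟨ cong (f m + g m +_) (shift-+ (suc d) Af Ag m) ⟨
  (f m + g m) + shift (suc d) (λ x → Af x + Ag x) m ∎
  where
  open ≡-Reasoning
  Af = adjoin (suc d) f
  Ag = adjoin (suc d) g

adjoin-shift : ∀ d e f → adjoin (suc d) (shift e f) ≗ shift e (adjoin (suc d) f)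
adjoin-shift d e f = adjoins-unique d (adjoin-adjoins d _) λ m → begin
  shift e F m
    ≡⟨ shift-cong-≤ e m (λ {x} _ → adjoin-adjoins d f x) ⟩
  shift e (λ x → f x + shift (suc d) F x) m
    ≡⟨ shift-+ e f _ m ⟩
  shift e f m + shift e (shift (suc d) F) m
    ≡⟨ cong (shift e f m +_) (shift-comm e (suc d) F m) ⟩
  shift e f m + shift (suc d) (shift e F) m ∎
  where
  open ≡-Reasoning
  F = adjoin (suc d) f

-- `adjoin (suc e)` is additive and commutes with shifts, so it preserves the recurrence that
-- defines `adjoin (suc d) f`.
adjoin-comm : ∀ d e f →
  adjoin (suc d) (adjoin (suc e) f) ≗ adjoin (suc e) (adjoin (suc d) f)
adjoin-comm d e f = adjoins-unique d (adjoin-adjoins d _) λ m → begin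
  adjoin (suc e) F m
    ≡⟨ adjoin-cong e (adjoin-adjoins d f) m ⟩
  adjoin (suc e) (λ x → f x + shift (suc d) F x) m
    ≡⟨ adjoin-+ e f _ m ⟩
  adjoin (suc e) f m + adjoin (suc e) (shift (suc d) F) m
    ≡⟨ cong (adjoin (suc e) f m +_) (adjoin-shift e (suc d) F m) ⟩
  adjoin (suc e) f m + shift (suc d) (adjoin (suc e) F) m ∎
  where
  open ≡-Reasoning
  F = adjoin (suc d) f

adjoin-step : ∀ d f m → adjoin (suc d) f (suc d + m) ≡ f (suc d + m) + adjoin (suc d) f m
adjoin-step d f m = trans (adjoin-adjoins d f (suc d + m))
  (cong (f (suc d + m) +_) (shift-≡ (suc d) (adjoin (suc d) f) m))

adjoin-≥ : ∀ d f m → f m ≤ adjoin (suc d) f m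
adjoin-≥ d f m = ≤-trans (m≤m+n _ _) (≤-reflexive (sym (adjoin-adjoins d f m)))

adjoin-≤-step : ∀ d f m → adjoin (suc d) f m ≤ adjoin (suc d) f (suc d + m)
adjoin-≤-step d f m = ≤-trans (m≤n+m _ _) (≤-reflexive (sym (adjoin-step d f m)))

-- `adjoin 1 f` consists of the partial sums of `f`.
adjoin-1-mono : ∀ f {m n} → m ≤ n → adjoin 1 f m ≤ adjoin 1 f n
adjoin-1-mono f {m} m≤n with ≤⇒≤′ m≤n
... | ≤′-refl     = ≤-refl
... | ≤′-step m≤′k = ≤-trans (adjoin-1-mono f (≤′⇒≤ m≤′k)) (adjoin-≤-step 0 f _)

-- Ranges of part sizes

adjoinRange : ℕ → ℕ → (ℕ → ℕ) → ℕ → ℕ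
adjoinRange lo zero    f = f
adjoinRange lo (suc j) f = adjoin (suc (lo + j)) (adjoinRange lo j f)

adjoin-adjoinRange : ∀ d lo j f →
  adjoin (suc d) (adjoinRange lo j f) ≗ adjoinRange lo j (adjoin (suc d) f)
adjoin-adjoinRange d lo zero    f m = refl
adjoin-adjoinRange d lo (suc j) f m = trans
  (adjoin-comm d (lo + j) (adjoinRange lo j f) m)
  (adjoin-cong (lo + j) (adjoin-adjoinRange d lo j f) m)

-- The count for the empty set of part sizes.
δ : ℕ → ℕ
δ zero    = 1
δ (suc _) = 0

-- The part sizes in parts≥k j range from k to 2 + j.
parts≥3 parts≥2 parts≥1 : ℕ → ℕ → ℕ
parts≥3 j = adjoinRange 2 j δ
parts≥2 j = adjoin 2 (parts≥3 j)
parts≥1 j = adjoin 1 (parts≥2 j)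

adjoinRange-assoc : ∀ j f → adjoinRange 2 j (adjoin 2 (adjoin 1 f)) ≡ adjoinRange 0 (2 + j) f
adjoinRange-assoc zero    f = refl
adjoinRange-assoc (suc j) f = cong (adjoin (3 + j)) (adjoinRange-assoc j f)

-- The estimates adjoin the sizes 1 and 2 last, while counting by the largest part adjoins all sizes
-- in increasing order.
parts≥1-adjoinRange : ∀ j → parts≥1 j ≗ adjoinRange 0 (2 + j) δ
parts≥1-adjoinRange j m = begin
  adjoin 1 (adjoin 2 (adjoinRange 2 j δ)) m
    ≡⟨ adjoin-comm 0 1 (adjoinRange 2 j δ) m ⟩
  adjoin 2 (adjoin 1 (adjoinRange 2 j δ)) m
    ≡⟨ adjoin-cong 1 (adjoin-adjoinRange 0 2 j δ) m ⟩
  adjoin 2 (adjoinRange 2 j (adjoin 1 δ)) m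
    ≡⟨ adjoin-adjoinRange 1 2 j (adjoin 1 δ) m ⟩
  adjoinRange 2 j (adjoin 2 (adjoin 1 δ)) m
    ≡⟨ cong (λ f → f m) (adjoinRange-assoc j δ) ⟩
  adjoinRange 0 (2 + j) δ m ∎
  where open ≡-Reasoning

parts≥3-mono : ∀ {i j} m → i ≤ j → parts≥3 i m ≤ parts≥3 j m
parts≥3-mono m i≤j with ≤⇒≤′ i≤j
... | ≤′-refl      = ≤-refl
... | ≤′-step {n = k} i≤′k = ≤-trans (parts≥3-mono m (≤′⇒≤ i≤′k)) (adjoin-≥ (2 + k) _ m)

parts≥1-mono : ∀ j {m n} → m ≤ n → parts≥1 j m ≤ parts≥1 j n
parts≥1-mono j = adjoin-1-mono (parts≥2 j)

-- P(n) = Q(n) + P(n-1), and P is nondecreasing.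
parts≥2+parts≥1 : ∀ j d m → parts≥2 j (suc d + m) + parts≥1 j m ≤ parts≥1 j (suc d + m)
parts≥2+parts≥1 j d m = begin
  parts≥2 j (suc d + m) + parts≥1 j m       ≤⟨ +-monoʳ-≤ _ (parts≥1-mono j (m≤n+m m d)) ⟩
  parts≥2 j (suc d + m) + parts≥1 j (d + m) ≡⟨ adjoin-step 0 (parts≥2 j) (d + m) ⟨
  parts≥1 j (suc d + m)                     ∎
  where open ≤-Reasoning

-- In `n` strides of length `d` from `x`, each stride raises `v` by at least a value of `u` that is
-- no smaller than `u x`.
*-≤-ladder : ∀ {u v : ℕ → ℕ} d → (∀ x → u x ≤ u (d + x)) → (∀ x → u (d + x) + v x ≤ v (d + x)) →
  ∀ n x → n * u x ≤ v (n * d + x)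
*-≤-ladder d u-mono u+v≤v zero    x = z≤n
*-≤-ladder {u} {v} d u-mono u+v≤v (suc n) x = begin
  u x + n * u x                         ≤⟨ +-mono-≤ (climb (suc n)) (*-≤-ladder d u-mono u+v≤v n x) ⟩
  u (suc n * d + x) + v (n * d + x)     ≡⟨ cong (λ y → u y + v (n * d + x)) (+-assoc d (n * d) x) ⟩
  u (d + (n * d + x)) + v (n * d + x)   ≤⟨ u+v≤v (n * d + x) ⟩
  v (d + (n * d + x))                   ≡⟨ cong v (+-assoc d (n * d) x) ⟨
  v (suc n * d + x)                     ∎
  where
  open ≤-Reasoning
  climb : ∀ k → u x ≤ u (k * d + x)
  climb zero    = ≤-refl
  climb (suc k) = ≤-trans (climb k)
    (≤-trans (u-mono _) (≤-reflexive (cong u (sym (+-assoc d (k * d) x)))))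

-- Negligible part sets

-- N does not depend on the bound j on the part sizes, so that j may grow with m.
Negligible : (f : ℕ → ℕ → ℕ) → Set
Negligible f = ∀ K → ∃[ N ] ∀ j m → N ≤ j → N ≤ m → K * f j m ≤ parts≥1 j m

-- With M = 2K and D = d + 1, unrolling g(MD+x) gives M values of f, each at most P/M^2, and g(x),
-- which the ladder bounds by P/M. The total is at most 2P/M = P/K.
adjoin-negligible : ∀ f d j₀ →
  (∀ j m → j₀ ≤ j → adjoin (suc d) (f j) m ≤ parts≥2 j m) →
  Negligible f → Negligible (λ j → adjoin (suc d) (f j))
-- Split off because `M = 2 * K` is cancelled below.
adjoin-negligible f d j₀ g≤parts≥2 negl zero = 0 , λ _ _ _ _ → z≤n
adjoin-negligible f d j₀ g≤parts≥2 negl K@(suc _) with negl (2 * K * (2 * K))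
-- The summand `M * D` leaves room to write `m` as `M * D + x` with `N ≤ x`.
... | N , small = N + M * D + j₀ , bound
  where
  open ≤-Reasoning
  M = 2 * K
  D = suc d

  unroll : ∀ j → N ≤ j → ∀ k x → N ≤ x →
    M * M * adjoin D (f j) (k * D + x) ≤ k * parts≥1 j (k * D + x) + M * M * adjoin D (f j) x
  unroll j N≤j zero    x N≤x = ≤-refl
  unroll j N≤j (suc k) x N≤x = subst
    (λ z → M * M * g z ≤ suc k * P z + M * M * g x) (sym (+-assoc D (k * D) x)) (begin
    M * M * g (D + y)                       ≡⟨ cong (M * M *_) (adjoin-step d (f j) y) ⟩
    M * M * (f j (D + y) + g y)             ≡⟨ *-distribˡ-+ (M * M) (f j (D + y)) (g y) ⟩
    M * M * f j (D + y) + M * M * g y       ≤⟨ +-mono-≤ (small j (D + y) N≤j N≤D+y) (unroll j N≤j k x N≤x) ⟩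
    P (D + y) + (k * P y + M * M * g x)     ≤⟨ +-monoʳ-≤ (P (D + y)) (+-monoˡ-≤ (M * M * g x) (*-monoʳ-≤ k (parts≥1-mono j (m≤n+m y D)))) ⟩
    P (D + y) + (k * P (D + y) + M * M * g x) ≡⟨ +-assoc (P (D + y)) (k * P (D + y)) (M * M * g x) ⟨
    suc k * P (D + y) + M * M * g x         ∎)
    where
    g = adjoin D (f j)
    P = parts≥1 j
    y = k * D + x
    N≤D+y : N ≤ D + y
    N≤D+y = ≤-trans N≤x (≤-trans (m≤n+m x (k * D)) (m≤n+m y D))

  bound′ : ∀ j x → j₀ ≤ j → N ≤ j → N ≤ x →
    K * adjoin D (f j) (M * D + x) ≤ parts≥1 j (M * D + x)
  bound′ j x j₀≤j N≤j N≤x = *-cancelˡ-≤ 2 (*-cancelˡ-≤ M (begin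
    M * (2 * (K * g y))     ≡⟨ cong (M *_) (*-assoc 2 K (g y)) ⟨
    M * (M * g y)           ≡⟨ *-assoc M M (g y) ⟨
    M * M * g y             ≤⟨ unroll j N≤j M x N≤x ⟩
    M * P y + M * M * g x   ≡⟨ cong (M * P y +_) (*-assoc M M (g x)) ⟩
    M * P y + M * (M * g x) ≤⟨ +-monoʳ-≤ (M * P y) (*-monoʳ-≤ M (*-≤-ladder D (adjoin-≤-step d (f j)) gain M x)) ⟩
    M * P y + M * P y       ≡⟨ *-distribˡ-+ M (P y) (P y) ⟨
    M * (P y + P y)         ≡⟨ cong (λ z → M * (P y + z)) (+-identityʳ (P y)) ⟨
    M * (2 * P y)           ∎))
    where
    g = adjoin D (f j)
    P = parts≥1 j
    y = M * D + x
    gain : ∀ z → g (D + z) + P z ≤ P (D + z)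
    gain z = ≤-trans (+-monoˡ-≤ (P z) (g≤parts≥2 j (D + z) j₀≤j)) (parts≥2+parts≥1 j d z)

  bound : ∀ j m → N + M * D + j₀ ≤ j → N + M * D + j₀ ≤ m →
    K * adjoin D (f j) m ≤ parts≥1 j m
  bound j m ≤j ≤m = subst (λ n → K * adjoin D (f j) n ≤ parts≥1 j n) (m+[n∸m]≡n MD≤m)
    (bound′ j (m ∸ M * D) (m+n≤o⇒n≤o (N + M * D) ≤j) (m+n≤o⇒m≤o N (m+n≤o⇒m≤o (N + M * D) ≤j))
      (m+n≤o⇒m≤o∸n N N+MD≤m))
    where
    N+MD≤m : N + M * D ≤ m
    N+MD≤m = m+n≤o⇒m≤o (N + M * D) ≤m
    MD≤m : M * D ≤ m
    MD≤m = m+n≤o⇒n≤o N N+MD≤m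

-- The sizes are adjoined one at a time. The size `3 + l` is available in `parts≥2 j` once
-- `suc l ≤ j`, whence the choice of `j₀`.
parts≥3-fixed-negligible : ∀ l → Negligible (λ _ → parts≥3 l)
-- The threshold 1 excludes `m = 0`, where the empty partition is counted.
parts≥3-fixed-negligible zero    K = 1 , λ { j (suc m) _ _ → ≤-trans (≤-reflexive (*-zeroʳ K)) z≤n }
parts≥3-fixed-negligible (suc l) = adjoin-negligible (λ _ → parts≥3 l) (2 + l) (suc l)
  (λ j m l<j → ≤-trans (parts≥3-mono m l<j) (adjoin-≥ 1 (parts≥3 j) m))
  (parts≥3-fixed-negligible l)

-- Removing the largest part k > 2 + l of a partition of m leaves a partition of m - k.
parts≥3-≤ : ∀ {l j} → l ≤ j → ∀ m →
  parts≥3 j m ≤ parts≥3 l m + shift (3 + l) (adjoin 1 (parts≥3 j)) m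
parts≥3-≤ {l} {j} l≤j m = m+n≤o⇒m≤o (parts≥3 j m) (telescope (≤⇒≤′ l≤j) ≤-refl)
  where
  open ≤-Reasoning
  T : ℕ → ℕ
  T = adjoin 1 (parts≥3 j)
  -- The term in `T` pays for the largest parts still to come: T(x) = C(x) + T(x-1) splits off those
  -- equal to `3 + k`.
  telescope : ∀ {k} → l ≤′ k → k ≤ j →
    parts≥3 k m + shift (3 + k) T m ≤ parts≥3 l m + shift (3 + l) T m
  telescope ≤′-refl _ = ≤-refl
  telescope (≤′-step {n = k} l≤′k) k<j = begin
    parts≥3 (suc k) m + shift (4 + k) T m
      ≡⟨ cong₂ _+_ (adjoin-adjoins (2 + k) (parts≥3 k) m)
           (trans (cong (λ e → shift e T m) (+-comm 1 (3 + k))) (sym (shift-shift (3 + k) 1 T m))) ⟩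
    (parts≥3 k m + shift (3 + k) (parts≥3 (suc k)) m) + shift (3 + k) (shift 1 T) m
      ≡⟨ +-assoc (parts≥3 k m) _ _ ⟩
    parts≥3 k m + (shift (3 + k) (parts≥3 (suc k)) m + shift (3 + k) (shift 1 T) m)
      ≡⟨ cong (parts≥3 k m +_) (shift-+ (3 + k) (parts≥3 (suc k)) (shift 1 T) m) ⟨
    parts≥3 k m + shift (3 + k) (λ x → parts≥3 (suc k) x + shift 1 T x) m
      ≤⟨ +-monoʳ-≤ (parts≥3 k m) (shift-mono (3 + k) (λ x →
           ≤-trans (+-monoˡ-≤ _ (parts≥3-mono x k<j))
             (≤-reflexive (sym (adjoin-adjoins 0 (parts≥3 j) x)))) m) ⟩
    parts≥3 k m + shift (3 + k) T m
      ≤⟨ telescope l≤′k (<⇒≤ k<j) ⟩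
    parts≥3 l m + shift (3 + l) T m ∎

-- Commuting the sizes 1 and 2 turns P into `adjoin 2 T`, so P(y+2) = T(y+2) + P(y) with T
-- nondecreasing.
parts≥1-≥ : ∀ j n x → n * adjoin 1 (parts≥3 j) x ≤ parts≥1 j (n * 2 + x)
parts≥1-≥ j n x = ≤-trans
  (*-≤-ladder 2 (λ y → adjoin-1-mono (parts≥3 j) (m≤n+m y 2))
    (λ y → ≤-reflexive (sym (adjoin-step 1 T y))) n x)
  (≤-reflexive (sym (adjoin-comm 0 1 (parts≥3 j) (n * 2 + x))))
  where T = adjoin 1 (parts≥3 j)

parts≥3-negligible : Negligible parts≥3
-- `l` is the length of 2K strides of 2, so that 2K T(x) ≤ P(l+x). Both summands of 2K C(m) are then
-- at most P(m).
parts≥3-negligible K with parts≥3-fixed-negligible (2 * K * 2) (2 * K)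
... | N , small = N + l , bound
  where
  open ≤-Reasoning
  l = 2 * K * 2
  bound : ∀ j m → N + l ≤ j → N + l ≤ m → K * parts≥3 j m ≤ parts≥1 j m
  bound j m ≤j ≤m = *-cancelˡ-≤ 2 (begin
    2 * (K * parts≥3 j m)
      ≡⟨ *-assoc 2 K _ ⟨
    2 * K * parts≥3 j m
      ≤⟨ *-monoʳ-≤ (2 * K) (parts≥3-≤ (m+n≤o⇒n≤o N ≤j) m) ⟩
    2 * K * (parts≥3 l m + shift (3 + l) T m)
      ≡⟨ *-distribˡ-+ (2 * K) (parts≥3 l m) _ ⟩
    2 * K * parts≥3 l m + 2 * K * shift (3 + l) T m
      ≤⟨ +-mono-≤ (small j m (m+n≤o⇒m≤o N ≤j) (m+n≤o⇒m≤o N ≤m))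
           (*-shift-≤ (3 + l) (2 * K) T (parts≥1 j)
             (λ x → ≤-trans (parts≥1-≥ j (2 * K) x) (parts≥1-mono j (m≤n+m (l + x) 3))) m) ⟩
    parts≥1 j m + parts≥1 j m
      ≡⟨ cong (parts≥1 j m +_) (+-identityʳ _) ⟨
    2 * parts≥1 j m ∎)
    where
    T : ℕ → ℕ
    T = adjoin 1 (parts≥3 j)

-- Opaque, since normalising the thresholds N is expensive.
opaque
  parts≥2-negligible : Negligible parts≥2
  parts≥2-negligible = adjoin-negligible parts≥3 1 0 (λ _ _ _ → ≤-refl) parts≥3-negligible

-- Lower bounds for partitions without part 1

parts≥3-zero : ∀ j → parts≥3 j 0 ≡ 1
parts≥3-zero zero    = refl
parts≥3-zero (suc j) = begin
  parts≥3 (suc j) 0 ≡⟨ adjoin-adjoins (2 + j) (parts≥3 j) 0 ⟩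
  parts≥3 j 0 + 0   ≡⟨ +-identityʳ (parts≥3 j 0) ⟩
  parts≥3 j 0       ≡⟨ parts≥3-zero j ⟩
  1                 ∎
  where open ≡-Reasoning

-- The single part `3 + i` is a partition of itself.
parts≥3-positive : ∀ {i j} → i < j → 1 ≤ parts≥3 j (3 + i)
parts≥3-positive {i} {j} i<j = begin
  1                                               ≡⟨ parts≥3-zero (suc i) ⟨
  parts≥3 (suc i) 0                               ≤⟨ adjoin-≤-step (2 + i) (parts≥3 i) 0 ⟩
  parts≥3 (suc i) (3 + i + 0)                     ≡⟨ cong (parts≥3 (suc i)) (+-identityʳ (3 + i)) ⟩
  parts≥3 (suc i) (3 + i)                         ≤⟨ parts≥3-mono (3 + i) i<j ⟩
  parts≥3 j (3 + i)                               ∎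
  where open ≤-Reasoning

-- Accounts for the partitions made of one part ≥ 3 and copies of 2: each removed 2 exposes one
-- more.
parts≥2-≥ : ∀ M i {j} → M * 2 + i ≤ j → M ≤ parts≥2 j (suc (M * 2 + i))
parts≥2-≥ zero    i ≤j = z≤n
parts≥2-≥ (suc M) i {j} ≤j = begin
  1 + M                                            ≤⟨ +-mono-≤ (parts≥3-positive (<⇒≤ ≤j)) (parts≥2-≥ M i (<⇒≤ (<⇒≤ ≤j))) ⟩
  parts≥3 j (3 + y) + parts≥2 j (1 + y)            ≡⟨ adjoin-step 1 (parts≥3 j) (1 + y) ⟨
  parts≥2 j (3 + y)                                ∎
  where
  open ≤-Reasoning
  y = M * 2 + i

-- Counting partitions

HasCount : {A : Set} → (A → Set) → ℕ → Set
HasCount P n = ∃[ xs ] Unique xs × (∀ x → x ∈ xs ⇔ P x) × length xs ≡ n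

module _ {A : Set} where

  -- Duplicate-free lists with the same members are permutations of each other.
  HasCount-unique : ∀ {P : A → Set} {m n} → HasCount P m → HasCount P n → m ≡ n
  HasCount-unique (xs , xs! , ∈xs , refl) (ys , ys! , ∈ys , refl) =
    ↭-length (∼bag⇒↭ (unique∧set⇒bag xs! ys! (λ {x} → ⇔-trans (∈xs x) (⇔-sym (∈ys x)))))

  HasCount-resp : ∀ {P Q : A → Set} {n} → (∀ x → P x ⇔ Q x) → HasCount P n → HasCount Q n
  HasCount-resp P⇔Q (xs , xs! , ∈xs , eq) = xs , xs! , (λ x → ⇔-trans (∈xs x) (P⇔Q x)) , eq

  HasCount-none : ∀ {P : A → Set} → (∀ x → ¬ P x) → HasCount P 0
  HasCount-none ¬P = [] , [] , (λ x → mk⇔ (λ ()) (λ px → contradiction px (¬P x))) , refl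

  HasCount-⊎ : ∀ {P Q : A → Set} {m n} → (∀ x → P x → ¬ Q x) →
    HasCount P m → HasCount Q n → HasCount (λ x → P x ⊎ Q x) (m + n)
  HasCount-⊎ P⇒¬Q (xs , xs! , ∈xs , refl) (ys , ys! , ∈ys , refl) =
    xs ++ ys ,
    ++⁺ xs! ys! (λ { {x} (x∈xs , x∈ys) → P⇒¬Q x (to (∈xs x) x∈xs) (to (∈ys x) x∈ys) }) ,
    (λ x → mk⇔
      ([ inj₁ ∘ to (∈xs x) , inj₂ ∘ to (∈ys x) ]′ ∘ ∈-++⁻ xs)
      [ ∈-++⁺ˡ ∘ from (∈xs x) , ∈-++⁺ʳ xs ∘ from (∈ys x) ]′) ,
    length-++ xs

  HasCount-map : ∀ {B : Set} {P : A → Set} {n} (f : A → B) → (∀ {x y} → f x ≡ f y → x ≡ y) →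
    HasCount P n → HasCount (λ y → ∃[ x ] P x × y ≡ f x) n
  HasCount-map f f-inj (xs , xs! , ∈xs , refl) =
    map f xs , map⁺ f-inj xs! ,
    (λ y → mk⇔
      (λ y∈ → let x , x∈ , eq = ∈-map⁻ f y∈ in x , to (∈xs x) x∈ , eq)
      (λ { (x , px , refl) → ∈-map⁺ f (from (∈xs x) px) })) ,
    length-map f xs

BoundedPartition : ℕ → ℕ → List ℕ → Set
BoundedPartition h n xs = All (_≤ h) xs × IsPartition n xs

linked-cons : ∀ {h xs} → All (_≤ h) xs → Linked _≥_ xs → Linked _≥_ (h ∷ xs)
linked-cons []        []     = [-]
linked-cons (x≤h ∷ _) linked = x≤h ∷ linked

all≤head : ∀ {x xs} → Linked _≥_ (x ∷ xs) → All (_≤ x) (x ∷ xs)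
all≤head = Linked⇒All (λ x≥y y≥z → ≤-trans y≥z x≥y) ≤-refl

-- The existential remainder `m` and the image under `h ∷_` fit `shift-count` and `HasCount-map`.
HeadsWith : ℕ → ℕ → List ℕ → Set
HeadsWith h n xs = ∃[ ys ] (∃[ m ] n ≡ h + m × BoundedPartition h m ys) × xs ≡ h ∷ ys

-- The head is the largest part, and it is either at most `h` or equal to `suc h`. This mirrors the
-- recurrence of `adjoin`.
boundedPartition-split : ∀ h n xs →
  (BoundedPartition h n xs ⊎ HeadsWith (suc h) n xs) ⇔ BoundedPartition (suc h) n xs
boundedPartition-split h n xs = mk⇔ join (split xs)
  where
  join : BoundedPartition h n xs ⊎ HeadsWith (suc h) n xs → BoundedPartition (suc h) n xs
  join (inj₁ (≤h , π)) = All.map m≤n⇒m≤1+n ≤h , π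
  join (inj₂ (ys , (m , refl , ≤1+h , linked , pos , refl) , refl)) =
    ≤-refl ∷ ≤1+h , linked-cons ≤1+h linked , s≤s z≤n ∷ pos , refl

  split : ∀ xs → BoundedPartition (suc h) n xs → BoundedPartition h n xs ⊎ HeadsWith (suc h) n xs
  split []       (_ , π) = inj₁ ([] , π)
  split (x ∷ xs) (x≤1+h ∷ ≤1+h , π@(linked , _ ∷ pos , refl)) with m≤n⇒m<n∨m≡n x≤1+h
  ... | inj₁ (s≤s x≤h) = inj₁ (All.map (λ y≤x → ≤-trans y≤x x≤h) (all≤head linked) , π)
  ... | inj₂ refl      = inj₂ (xs , (sum xs , refl , ≤1+h , Linked.tail linked , pos , refl) , refl)

shift-count : ∀ {P : ℕ → List ℕ → Set} d {f} n → (∀ m → n ≡ d + m → HasCount (P m) (f m)) →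
  HasCount (λ xs → ∃[ m ] n ≡ d + m × P m xs) (shift d f n)
shift-count {P} d {f} n count with d ≤? n
... | no d≰n = subst (HasCount _) (sym (shift-< d f (≰⇒> d≰n)))
  (HasCount-none (λ { _ (m , refl , _) → d≰n (m≤m+n d m) }))
... | yes d≤n with n ∸ d | sym (m+[n∸m]≡n d≤n)
... | m | refl = subst (HasCount _) (sym (shift-≡ d f m)) (HasCount-resp
  (λ xs → mk⇔ (λ π → m , refl , π)
    (λ { (k , eq , π) → subst (λ l → P l xs) (sym (+-cancelˡ-≡ d m k eq)) π }))
  (count m refl))

-- The outer induction adjoins the size `suc h`. The inner one is on `n`, since removing a part
-- `suc h` keeps the bound and lowers the sum.
boundedPartition-count : ∀ h n → HasCount (BoundedPartition h n) (adjoinRange 0 h δ n)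
boundedPartition-count zero zero =
  [] ∷ [] , [] ∷ [] , (λ xs → mk⇔ (λ { (here refl) → [] , [] , [] , refl }) (here ∘ empty xs)) , refl
  where
  empty : ∀ xs → BoundedPartition 0 0 xs → xs ≡ []
  empty []       _                         = refl
  empty (x ∷ xs) (x≤0 ∷ _ , _ , 1≤x ∷ _ , _) = contradiction (≤-trans 1≤x x≤0) λ ()
boundedPartition-count zero (suc n) = HasCount-none λ
  { []       (_ , _ , _ , ())
  ; (x ∷ xs) (x≤0 ∷ _ , _ , 1≤x ∷ _ , _) → contradiction (≤-trans 1≤x x≤0) λ () }
boundedPartition-count (suc h) = <-rec _ λ n rec →
  subst (HasCount _) (sym (adjoin-adjoins h (adjoinRange 0 h δ) n))
    (HasCount-resp (boundedPartition-split h n)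
      (HasCount-⊎
        (λ { _ (1+h≤h ∷ _ , _) (_ , _ , refl) → <-irrefl refl 1+h≤h })
        (boundedPartition-count h n)
        (HasCount-map (suc h ∷_) ∷-injectiveʳ
          (shift-count (suc h) n (λ { m refl → rec (s≤s (m≤n+m m h)) })))))

parts≤sum : ∀ xs → All (_≤ sum xs) xs
parts≤sum []       = []
parts≤sum (x ∷ xs) = m≤m+n x _ ∷ All.map (λ y≤ → ≤-trans y≤ (m≤n+m _ x)) (parts≤sum xs)

-- No part exceeds `n`, so the bound `2 + j` on the parts is vacuous.
p≡parts≥1 : ∀ {j n} → n ≤ 2 + j → p n ≡ parts≥1 j n
p≡parts≥1 {j} {n} n≤2+j = trans
  (HasCount-unique
    (partitions n , partitions-unique n , ∈-partitions n , refl)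
    (HasCount-resp
      (λ xs → mk⇔ proj₂ (λ { π@(_ , _ , refl) → All.map (λ x≤n → ≤-trans x≤n n≤2+j) (parts≤sum xs) , π }))
      (boundedPartition-count (2 + j) n)))
  (sym (parts≥1-adjoinRange j n))

-- The increment of p

-- This is Q(n+1) = p(n+1) - p(n): the index `n` admits sizes up to `n + 2`, which is no restriction
-- on partitions of `n + 1`.
Δp : ℕ → ℕ
Δp n = parts≥2 n (suc n)

Δp-large : ∀ M {n} → M * 2 ≤ n → M ≤ Δp n
Δp-large M {n} 2M≤n with n ∸ M * 2 | m+[n∸m]≡n 2M≤n
... | i | refl = parts≥2-≥ M i ≤-refl

parts≥1-suc : ∀ n → parts≥1 n (suc n) ≡ Δp n + parts≥1 n n
parts≥1-suc n = adjoin-step 0 (parts≥2 n) n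

Δp-small : ∀ K → ∃[ N ] ∀ n → N ≤ n → K * Δp n ≤ parts≥1 n n
-- Negligibility compares with P(n+1) = Q(n+1) + P(n); the extra copy of Q(n+1) cancels.
Δp-small K with parts≥2-negligible (suc K)
... | N , small = N , λ n N≤n → +-cancelˡ-≤ (Δp n) _ _
  (≤-trans (small n (suc n) N≤n (m≤n⇒m≤1+n N≤n)) (≤-reflexive (parts≥1-suc n)))

n≤2Δp+1 : ∀ n → n ≤ Δp n * 2 + 1
n≤2Δp+1 n = ≮⇒≥ λ 2Δp+1<n → <-irrefl refl
  (Δp-large (suc (Δp n)) (≤-trans (≤-reflexive (cong suc (+-comm 1 (Δp n * 2)))) 2Δp+1<n))

-- A subtraction-free form of K Q(n+1) < H(n).
Δp-eventually : ∀ K → ∃[ N ] ∀ n → N ≤ n → 2 ≤ Δp n × Δp n * K + n < parts≥1 n n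
Δp-eventually K with Δp-small (K + 3)
-- Of the three extra copies of `Δp n`, two and 1 cover `n`, and the third exceeds that 1. The 4
-- gives `2 ≤ Δp n`.
... | N , small = N + 4 , λ n ≤n → let 2≤Δp = Δp-large 2 (m+n≤o⇒n≤o N ≤n) in 2≤Δp , (begin-strict
  Δp n * K + n                ≤⟨ +-monoʳ-≤ (Δp n * K) (n≤2Δp+1 n) ⟩
  Δp n * K + (Δp n * 2 + 1)   <⟨ +-monoʳ-< (Δp n * K) (+-monoʳ-< (Δp n * 2) 2≤Δp) ⟩
  Δp n * K + (Δp n * 2 + Δp n) ≡⟨ cong (λ z → Δp n * K + z) (trans (+-comm (Δp n * 2) (Δp n)) (sym (*-suc (Δp n) 2))) ⟩
  Δp n * K + Δp n * 3         ≡⟨ *-distribˡ-+ (Δp n) K 3 ⟨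
  Δp n * (K + 3)              ≡⟨ *-comm (Δp n) (K + 3) ⟩
  (K + 3) * Δp n              ≤⟨ small n (m+n≤o⇒m≤o N ≤n) ⟩
  parts≥1 n n                 ∎)
  where open ≤-Reasoning

-- Integers and rationals

open import Data.Integer as ℤ using (ℤ; +_; +[1+_]; -[1+_])
import Data.Integer.Properties as ℤ
open import Data.Integer.Tactic.RingSolver using (solve-∀)
open import Data.Rational as ℚ using (ℚ; mkℚ; 0ℚ; 1ℚ; ↧ₙ_)
import Data.Rational.Properties as ℚ
open import Data.Rational.Unnormalised as ℚᵘ using (mkℚᵘ)
import Data.Rational.Unnormalised.Properties as ℚᵘ
import Data.Nat.Coprimality as Coprimality

-- Already in lowest terms, so it computes for a variable `z`, whereas `ι z` normalises through a
-- gcd.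
int : ℤ → ℚ
int z = mkℚ z 0 (Coprimality.sym (Coprimality.1-coprimeTo ℤ.∣ z ∣))

ι≡int : ∀ z → ι z ≡ int z
ι≡int z = ℚ.↥p/↧p≡p (int z)

-- The equation a/b - l = (a - lb)/b after cross-multiplication. One denominator arises as
-- `1 * suc b`, hence the separate `b` and `c`.
difference-of-quotients : ∀ a b c l → b ≡ c →
  ((a ℤ.* ℤ.1ℤ) ℤ.* ℤ.1ℤ ℤ.+ (ℤ.- l) ℤ.* b) ℤ.* c ≡ (a ℤ.- l ℤ.* c) ℤ.* (b ℤ.* ℤ.1ℤ)
difference-of-quotients a b _ l refl = identity a b l
  where
  identity : ∀ a b l →
    ((a ℤ.* ℤ.1ℤ) ℤ.* ℤ.1ℤ ℤ.+ (ℤ.- l) ℤ.* b) ℤ.* b ≡ (a ℤ.- l ℤ.* b) ℤ.* (b ℤ.* ℤ.1ℤ)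
  identity = solve-∀

toℚᵘ-∣÷-∣ : ∀ a b l → ℚ.toℚᵘ ℚ.∣ int a ℚ.÷ int +[1+ b ] ℚ.- int l ∣
   ℚᵘ.≃ mkℚᵘ (+ ℤ.∣ a ℤ.- l ℤ.* +[1+ b ] ∣) b
toℚᵘ-∣÷-∣ a b l = ℚᵘ.≃-trans (ℚ.toℚᵘ-homo-∣-∣ (x ℚ.÷ y ℚ.- z)) (ℚᵘ.∣-∣-cong quotient)
  where
  open import Relation.Binary.Reasoning.Setoid ℚᵘ.≃-setoid
  x = int a
  y = int +[1+ b ]
  z = int l
  quotient : ℚ.toℚᵘ (x ℚ.÷ y ℚ.- z) ℚᵘ.≃ mkℚᵘ (a ℤ.- l ℤ.* +[1+ b ]) b
  quotient = begin
    ℚ.toℚᵘ (x ℚ.÷ y ℚ.- z)                          ≈⟨ ℚ.toℚᵘ-homo-+ (x ℚ.÷ y) (ℚ.- z) ⟩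
    ℚ.toℚᵘ (x ℚ.÷ y) ℚᵘ.+ ℚ.toℚᵘ (ℚ.- z)            ≈⟨ ℚᵘ.+-cong (ℚ.toℚᵘ-homo-* x (ℚ.1/ y)) (ℚ.toℚᵘ-homo‿- z) ⟩
    mkℚᵘ a 0 ℚᵘ.* mkℚᵘ ℤ.1ℤ b ℚᵘ.- mkℚᵘ l 0         ≈⟨ ℚᵘ.*≡* (difference-of-quotients a (+ (1 * suc b)) +[1+ b ] l (cong +_ (*-identityˡ (suc b)))) ⟩
    mkℚᵘ (a ℤ.- l ℤ.* +[1+ b ]) b                   ∎

-- A positive ε has numerator at least 1, so a ratio below 1 / `↧ ε` is below ε.
bounded-ratio : ∀ a b l ε → 0ℚ ℚ.< ε → + 0 ℤ.< b →
  + ℤ.∣ a ℤ.- l ℤ.* b ∣ ℤ.* ℚ.↧ ε ℤ.< b →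
  Σ[ b≢0 ∈ ℚ.NonZero (ι b) ] ℚ.∣ ℚ._÷_ (ι a) (ι b) {{b≢0}} ℚ.- ι l ∣ ℚ.< ε
bounded-ratio a +[1+ b ] l ε@(mkℚ _ _ _) ε>0 _ small
  rewrite ι≡int a | ι≡int l | ι≡int +[1+ b ] = _ , ℚ.toℚᵘ-cancel-<
    (ℚᵘ.<-respˡ-≃ (ℚᵘ.≃-sym (toℚᵘ-∣÷-∣ a b l)) (ℚᵘ.*<* (ℤ.<-≤-trans small (bound ε (ℚ.positive ε>0)))))
  where
  bound : ∀ ε → ℚ.Positive ε → +[1+ b ] ℤ.≤ ℚ.↥ ε ℤ.* +[1+ b ]
  bound (mkℚ +[1+ e ] _ _) _ = ℤ.+≤+ (m≤m+n (suc b) (e * suc b))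
bounded-ratio a (+ zero) l ε ε>0 (ℤ.+<+ ())

-- `G` and `H` in terms of the increment of `p`

+-∸ : ∀ {m n} → n ≤ m → + m ℤ.- + n ≡ + (m ∸ n)
+-∸ {m} {n} n≤m = trans (ℤ.m-n≡m⊖n m n) (ℤ.⊖-≥ n≤m)

H≡ : ∀ n → H n ≡ + parts≥1 n n ℤ.- + n
H≡ n = cong (λ m → + m ℤ.- + n) (p≡parts≥1 (m≤n+m n 2))

H-suc≡ : ∀ n → H (suc n) ≡ + Δp n ℤ.+ + parts≥1 n n ℤ.- (ℤ.1ℤ ℤ.+ + n)
H-suc≡ n = cong (λ m → + m ℤ.- + suc n)
  (trans (p≡parts≥1 (n≤1+n (suc n))) (parts≥1-suc n))

-- One unit of the 2 comes from the term -n of `H`, the other from the definition of the gap.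
G≡ : ∀ {n} → 2 ≤ Δp n → G n ≡ + (Δp n ∸ 2)
G≡ {n} 2≤Δp = begin
  G n                  ≡⟨ cong₂ (λ h′ h → h′ ℤ.- h ℤ.- ℤ.1ℤ) (H-suc≡ n) (H≡ n) ⟩
  _                    ≡⟨ identity (+ Δp n) (+ parts≥1 n n) (+ n) ⟩
  + Δp n ℤ.- + 2       ≡⟨ +-∸ 2≤Δp ⟩
  + (Δp n ∸ 2)         ∎
  where
  open ≡-Reasoning
  identity : ∀ d p n → (d ℤ.+ p ℤ.- (ℤ.1ℤ ℤ.+ n)) ℤ.- (p ℤ.- n) ℤ.- ℤ.1ℤ ≡ d ℤ.- + 2
  identity = solve-∀

H-suc-H≡ : ∀ {n} → 1 ≤ Δp n → H (suc n) ℤ.- ℤ.1ℤ ℤ.* H n ≡ + (Δp n ∸ 1)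
H-suc-H≡ {n} 1≤Δp = begin
  H (suc n) ℤ.- ℤ.1ℤ ℤ.* H n ≡⟨ cong₂ (λ h′ h → h′ ℤ.- ℤ.1ℤ ℤ.* h) (H-suc≡ n) (H≡ n) ⟩
  _                    ≡⟨ identity (+ Δp n) (+ parts≥1 n n) (+ n) ⟩
  + Δp n ℤ.- + 1       ≡⟨ +-∸ 1≤Δp ⟩
  + (Δp n ∸ 1)         ∎
  where
  open ≡-Reasoning
  identity : ∀ d p n → (d ℤ.+ p ℤ.- (ℤ.1ℤ ℤ.+ n)) ℤ.- ℤ.1ℤ ℤ.* (p ℤ.- n) ≡ d ℤ.- + 1
  identity = solve-∀

<-H : ∀ {m n} → m + n < parts≥1 n n → + m ℤ.< H n
<-H {m} {n} m+n<P = subst (+ m ℤ.<_) (sym (H≡ n)) (begin-strict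
  + m                       ≡⟨ cong +_ (m+n∸n≡m m n) ⟨
  + (m + n ∸ n)             ≡⟨ +-∸ (m≤n+m n m) ⟨
  + (m + n) ℤ.- + n         <⟨ ℤ.+-monoˡ-< (ℤ.- + n) (ℤ.+<+ m+n<P) ⟩
  + parts≥1 n n ℤ.- + n     ∎)
  where open ℤ.≤-Reasoning

-- The remainder is required to be a natural number, so that no absolute value occurs.
QuotientTendsTo-ι : ∀ (a b : ℕ → ℤ) l →
  (∀ K → ∃[ N ] ∀ n → n ≥ N → ∃[ r ] a n ℤ.- l ℤ.* b n ≡ + r × + (r * K) ℤ.< b n) →
  QuotientTendsTo (λ n → ι (a n)) (λ n → ι (b n)) (ι l)
QuotientTendsTo-ι a b l small ε ε>0 with small (↧ₙ ε)
... | N , bound = N , λ n n≥N → let r , eq , r<b = bound n n≥N in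
  bounded-ratio (a n) (b n) l ε ε>0 (ℤ.≤-<-trans (ℤ.+≤+ z≤n) r<b)
    (subst (ℤ._< b n) (trans (ℤ.pos-* r (↧ₙ ε)) (cong (λ z → + ℤ.∣ z ∣ ℤ.* ℚ.↧ ε) (sym eq))) r<b)

-- Serves both quotients: `l = 0`, `k = 2` for `G`, and `l = 1`, `k = 1` for `H (suc n)`.
Δp-quotient : ∀ (a : ℕ → ℤ) l k → k ≤ 2 → (∀ {n} → k ≤ Δp n → a n ℤ.- l ℤ.* H n ≡ + (Δp n ∸ k)) →
  QuotientTendsTo (λ n → ι (a n)) (λ n → ι (H n)) (ι l)
Δp-quotient a l k k≤2 a≡ = QuotientTendsTo-ι a H l λ K → let N , bound = Δp-eventually K in
  N , λ n n≥N → let 2≤Δp , <p = bound n n≥N in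
    Δp n ∸ k , a≡ (≤-trans k≤2 2≤Δp) ,
    <-H (≤-<-trans (+-monoˡ-≤ n (*-monoˡ-≤ K (m∸n≤m (Δp n) k))) <p)

G-tendsTo : TendsToInfinity G
-- Below a negative bound it is enough that `G n` is a natural number.
G-tendsTo -[1+ m ] = let N , bound = Δp-eventually 0 in
  N , λ n n≥N → subst (-[1+ m ] ℤ.≤_) (sym (G≡ (proj₁ (bound n n≥N)))) ℤ.-≤+
G-tendsTo (+ M) = (M + 2) * 2 , λ n n≥N → let M+2≤Δp = Δp-large (M + 2) n≥N in
  subst (+ M ℤ.≤_) (sym (G≡ (m+n≤o⇒n≤o M M+2≤Δp))) (ℤ.+≤+ (m+n≤o⇒m≤o∸n M M+2≤Δp))

corollary4p2 : TendsToInfinity G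
    × QuotientTendsTo (λ n → ι (G n)) (λ n → ι (H n)) 0ℚ
    × QuotientTendsTo (λ n → ι (H (suc n))) (λ n → ι (H n)) 1ℚ
corollary4p2 = G-tendsTo ,
  Δp-quotient G ℤ.0ℤ 2 ≤-refl (λ {n} 2≤Δp → trans (minus-zero (G n) (H n)) (G≡ 2≤Δp)) ,
  Δp-quotient (λ n → H (suc n)) ℤ.1ℤ 1 (s≤s z≤n) H-suc-H≡
  where
  minus-zero : ∀ g h → g ℤ.- ℤ.0ℤ ℤ.* h ≡ g
  minus-zero = solve-∀
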